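{- Let $A$ be a set with $|A|=2$, let $n\geq 3$ and let $I_n=\{0,\ldots,n-1\}$. Let $\mathrm{Eq}_n(A)\subseteq A^n$ be the set of strings $w$ having at least two identical consecutive letters, i.e. $w_i=w_{i+1}$ for some $0\le i<n-1$. The minimal simplicial complexes over $I_n$ generating $\mathrm{Eq}_n(A)$ are exactly the spanning trees on $I_n$.
   Context: All sets are finite (possibly empty). For $f:B^J\to A^I$ write $f_i(x)=f(x)_i$. For $i\in I$, the input window $\mathcal{W}_f(i)$ is the smallest set $W\subseteq J$ (it exists) such that for all $x,y\in B^J$, $x|_W=y|_W$ implies $f_i(x)=f_i(y)$. A simplicial complex (or complex) over $I$ is a collection of subsets of $I$ (its simplices) closed under taking subsets; the empty set is a simplex of every complex. The communication complex $K_f$ of $f$ is the complex over $I$ in which a non-empty $S\subseteq I$ is a simplex iff $\bigcap_{i\in S}\mathcal{W}_f(i)\neq\emptyset$. A complex $K$ over $I$ generates a language $L\subseteq A^I$ if there exist finite sets $B,J$ and a function $f:B^J\to A^I$ with image exactly $L$ and $K_f\subseteq K$. A complex generating $L$ is minimal if no complex strictly contained in it generates $L$. We write $A^n$ for $A^{I_n}$. A spanning tree on $I_n$ is a tree (connected acyclic graph) with vertex set $I_n$, regarded as a complex whose simplices are $\emptyset$, the singletons and the edges. -}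

module Defs where

open import Data.Bool.Properties using () renaming (_≟_ to _≟ᵇ_)
open import Data.Fin using (Fin; toℕ; zero; suc)
open import Data.Fin.Properties using (any?; all?; inj⇒≟) renaming (_≟_ to _≟ᶠ_)
open import Data.Fin.Subset using (Subset; _∈_; _∉_; _⊆_; _⊂_; _∩_; _∪_; ⁅_⁆; ⊥; ⊤; Empty)
open import Data.Fin.Subset.Properties
  using (_∈?_; _⊆?_; nonempty?; anySubset?; ∈⊤; ∉⊥; ⊆-antisym; ⊥⊆; p∩q⊆p; p∩q⊆q;
         x∈p∩q⁺; x∈p∪q⁺; x∈p∪q⁻; x∈⁅y⁆⇒x≡y)
open import Data.Fin.Subset.Induction using (⊂-wellFounded)
open import Data.List using (List; _∷_; []; _++_; length)
open import Data.List.Relation.Unary.Linked using (Linked)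
open import Data.List.Relation.Unary.Unique.Propositional using (Unique)
open import Data.Nat using (ℕ; zero; suc; _≤_)
open import Data.Product using (Σ; ∃; ∃₂; _×_; _,_; proj₁; proj₂)
open import Data.Sum using (_⊎_; inj₁; inj₂; [_,_]′)
open import Data.Vec using (Vec; []; _∷_; lookup; tabulate)
open import Data.Vec.Properties using (≡-dec; lookup∘tabulate)
open import Function using (_∘_)
open import Function.Bundles using (_↔_; _⇔_)
open import Function.Properties.Inverse using (↔⇒↣)
open import Induction.WellFounded using (Acc; acc)
open import Level using (0ℓ)
open import Relation.Binary using (Rel; Symmetric; DecidableEquality)
import Relation.Binary as B
open import Relation.Binary.Construct.Closure.ReflexiveTransitive using (Star)
open import Relation.Binary.PropositionalEquality using (_≡_; refl; sym; trans; cong; subst)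
open import Relation.Nullary using (¬_; Dec; yes; no; contradiction)
open import Relation.Nullary.Decidable using (map′; ¬?; _×-dec_; _⊎-dec_; _→-dec_; decidable-stable)
open import Relation.Unary using (Pred; Decidable; _≐_)
import Relation.Unary as U

-- A collection of subsets of a finite set is a decidable predicate;
-- two collections are equal when the predicates are extensionally equal (_≐_).
record Complex (n : ℕ) : Set₁ where
  field
    Simplex  : Pred (Subset n) 0ℓ
    simplex? : Decidable Simplex
    empty    : Simplex ⊥
    down     : ∀ {S T} → S ⊆ T → Simplex T → Simplex S

open Complex public using (Simplex)

module _ {n : ℕ} where

  infix 4 _⊆ᶜ_ _⊂ᶜ_ _≐ᶜ_

  _⊆ᶜ_ _⊂ᶜ_ _≐ᶜ_ : Rel (Complex n) 0ℓ
  K ⊆ᶜ L = Simplex K U.⊆ Simplex L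
  K ⊂ᶜ L = Simplex K U.⊂ Simplex L
  K ≐ᶜ L = Simplex K ≐ Simplex L

Language : Set → ℕ → Set₁
Language A n = Pred (Vec A n) 0ℓ

-- Powers B^J are taken to be vectors rather than functions Fin j → B, so that
-- a map f out of B^J automatically respects pointwise equality.
module _ {A : Set} {b j n : ℕ} (f : Vec (Fin b) j → Vec A n) (i : Fin n) where

  AgreeOn : Subset j → Rel (Vec (Fin b) j) 0ℓ
  AgreeOn W x y = ∀ k → k ∈ W → lookup x k ≡ lookup y k

  Determines : Pred (Subset j) 0ℓ
  Determines W = ∀ x y → AgreeOn W x y → lookup (f x) i ≡ lookup (f y) i

  IsInputWindow : Pred (Subset j) 0ℓ
  IsInputWindow W = Determines W × (∀ W′ → Determines W′ → W ⊆ W′)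

  determines-⊤ : Determines ⊤
  determines-⊤ x y x≈y = cong (λ z → lookup (f z) i) (ext x y λ k → x≈y k ∈⊤)
    where
    ext : ∀ {m} (u v : Vec (Fin b) m) → (∀ k → lookup u k ≡ lookup v k) → u ≡ v
    ext []      []      _ = refl
    ext (p ∷ u) (q ∷ v) e with refl ← e zero = cong (p ∷_) (ext u v (e ∘ suc))

  determines-∩ : ∀ {V W} → Determines V → Determines W → Determines (V ∩ W)
  determines-∩ {V} {W} dV dW x y x≈y = trans (dV x z x≈z) (dW z y z≈y)
    where
    mix : ∀ k → Dec (k ∈ V) → Fin b
    mix k (yes _) = lookup x k
    mix k (no  _) = lookup y k

    z : Vec (Fin b) j
    z = tabulate (λ k → mix k (k ∈? V))

    mix-V : ∀ k (d : Dec (k ∈ V)) → k ∈ V → lookup x k ≡ mix k d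
    mix-V k (yes _)   _   = refl
    mix-V k (no  k∉V) k∈V = contradiction k∈V k∉V

    mix-W : ∀ k (d : Dec (k ∈ V)) → k ∈ W → mix k d ≡ lookup y k
    mix-W k (yes k∈V) k∈W = x≈y k (x∈p∩q⁺ (k∈V , k∈W))
    mix-W k (no  _)   _   = refl

    x≈z : AgreeOn V x z
    x≈z k k∈V = trans (mix-V k (k ∈? V) k∈V) (sym (lookup∘tabulate _ k))

    z≈y : AgreeOn W z y
    z≈y k k∈W = trans (lookup∘tabulate _ k) (mix-W k (k ∈? V) k∈W)

  module _ (_≟_ : DecidableEquality A) where

    determines? : Decidable Determines
    determines? W = allVec? λ x → allVec? λ y →
      all? (λ k → (k ∈? W) →-dec (lookup x k ≟ᶠ lookup y k))
        →-dec (lookup (f x) i ≟ lookup (f y) i)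
      where
      allVec? : ∀ {m} {P : Pred (Vec (Fin b) m) 0ℓ} → Decidable P → Dec (∀ x → P x)
      allVec? {zero}  P? = map′ (λ { p [] → p }) (λ h → h []) (P? [])
      allVec? {suc m} P? = map′ (λ { h (c ∷ x) → h c x }) (λ h c x → h (c ∷ x))
        (all? λ c → allVec? λ x → P? (c ∷ x))

    inputWindow-exists : ∃ IsInputWindow
    inputWindow-exists = shrink ⊤ (⊂-wellFounded ⊤) determines-⊤
      where
      shrink : ∀ W → Acc _⊂_ W → Determines W → ∃ IsInputWindow
      shrink W (acc rec) dW
        with anySubset? (λ V → determines? V ×-dec ¬? (W ⊆? V))
      ... | no none = W , dW , λ V dV →
              decidable-stable (W ⊆? V) (λ W⊈V → none (V , dV , W⊈V))
      ... | yes (V , dV , W⊈V) =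
              shrink (W ∩ V) (rec (p∩q⊆p W V , outsider)) (determines-∩ dW dV)
        where
        outsider : ∃ λ k → k ∈ W × k ∉ W ∩ V
        outsider with any? (λ k → (k ∈? W) ×-dec ¬? (k ∈? W ∩ V))
        ... | yes p = p
        ... | no ¬p = contradiction
                (λ {k} k∈W → p∩q⊆q W V (decidable-stable (k ∈? W ∩ V) λ k∉ → ¬p (k , k∈W , k∉)))
                W⊈V

module _ {A : Set} {a : ℕ} (A↔Fin : A ↔ Fin a) where

  module _ {b j n : ℕ} (f : Vec (Fin b) j → Vec A n) where

    inputWindow : Fin n → Subset j
    inputWindow i = proj₁ (inputWindow-exists f i (inj⇒≟ (↔⇒↣ A↔Fin)))

    isInputWindow : ∀ i → IsInputWindow f i (inputWindow i)
    isInputWindow i = proj₂ (inputWindow-exists f i (inj⇒≟ (↔⇒↣ A↔Fin)))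

    communicationComplex : Complex n
    communicationComplex = record
      { Simplex  = λ S → Empty S ⊎ (∃ λ k → ∀ i → i ∈ S → k ∈ inputWindow i)
      ; simplex? = λ S → ¬? (nonempty? S) ⊎-dec
                         any? λ k → all? λ i → (i ∈? S) →-dec (k ∈? inputWindow i)
      ; empty    = inj₁ λ { (_ , i∈⊥) → ∉⊥ i∈⊥ }
      ; down     = λ { S⊆T (inj₁ T-empty) → inj₁ λ { (i , i∈S) → T-empty (i , S⊆T i∈S) }
                     ; S⊆T (inj₂ (k , h)) → inj₂ (k , λ i i∈S → h i (S⊆T i∈S)) }
      }

  module _ {n : ℕ} where

    HasImage : ∀ {b j} → (Vec (Fin b) j → Vec A n) → Language A n → Set
    HasImage f L = ∀ w → L w ⇔ (∃ λ x → f x ≡ w)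

    Generates : Complex n → Language A n → Set
    Generates K L = ∃₂ λ b j → Σ (Vec (Fin b) j → Vec A n) λ f →
      HasImage f L × communicationComplex f ⊆ᶜ K

    MinimalGenerating : Complex n → Language A n → Set₁
    MinimalGenerating K L =
      Generates K L × (∀ K′ → K′ ⊂ᶜ K → ¬ Generates K′ L)

Eq : (A : Set) (n : ℕ) → Language A n
Eq A n w = ∃₂ λ (i i′ : Fin n) → toℕ i′ ≡ suc (toℕ i) × lookup w i ≡ lookup w i′

record Graph (n : ℕ) : Set₁ where
  field
    Edge   : Rel (Fin n) 0ℓ
    edge?  : B.Decidable Edge
    symm   : Symmetric Edge
    irrefl : ∀ v → ¬ Edge v v

module _ {n : ℕ} (G : Graph n) where
  open Graph G

  Connected : Set
  Connected = ∀ u v → Star Edge u v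

  -- The vertices v ∷ vs are pairwise distinct, and the walk through them
  -- returns to v; length at least 3 excludes going back and forth along an edge.
  IsCycle : Fin n → List (Fin n) → Set
  IsCycle v vs = 3 ≤ length (v ∷ vs) × Unique (v ∷ vs) × Linked Edge (v ∷ vs ++ v ∷ [])

  Acyclic : Set
  Acyclic = ∀ v vs → ¬ IsCycle v vs

  IsTree : Set
  IsTree = Connected × Acyclic

  GraphSimplex : Pred (Subset n) 0ℓ
  GraphSimplex S =
      S ≡ ⊥
    ⊎ (∃ λ v → S ≡ ⁅ v ⁆)
    ⊎ (∃₂ λ u v → Edge u v × S ≡ ⁅ u ⁆ ∪ ⁅ v ⁆)

  graphComplex : Complex n
  graphComplex = record
    { Simplex  = GraphSimplex
    ; simplex? = λ S → (S ≟ˢ ⊥) ⊎-dec (any? (λ v → S ≟ˢ ⁅ v ⁆)) ⊎-dec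
                       any? (λ u → any? λ v → edge? u v ×-dec (S ≟ˢ (⁅ u ⁆ ∪ ⁅ v ⁆)))
    ; empty    = inj₁ refl
    ; down     = down
    }
    where
    _≟ˢ_ : DecidableEquality (Subset n)
    _≟ˢ_ = ≡-dec _≟ᵇ_

    ⁅⁆⊆ : ∀ {v S} → v ∈ S → ⁅ v ⁆ ⊆ S
    ⁅⁆⊆ {v} {S} v∈S k∈ = subst (_∈ S) (sym (x∈⁅y⁆⇒x≡y v k∈)) v∈S

    drop : ∀ {S} v T → S ⊆ ⁅ v ⁆ ∪ T → ¬ v ∈ S → S ⊆ T
    drop {S} v T S⊆ v∉S k∈S with x∈p∪q⁻ ⁅ v ⁆ T (S⊆ k∈S)
    ... | inj₁ k∈v = contradiction (subst (_∈ S) (x∈⁅y⁆⇒x≡y v k∈v) k∈S) v∉S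
    ... | inj₂ k∈T = k∈T

    point : ∀ {S} v → S ⊆ ⁅ v ⁆ → GraphSimplex S
    point {S} v S⊆ with v ∈? S
    ... | yes v∈S = inj₂ (inj₁ (v , ⊆-antisym S⊆ (⁅⁆⊆ v∈S)))
    ... | no  v∉S = inj₁ (⊆-antisym
            (λ k∈S → contradiction (subst (_∈ S) (x∈⁅y⁆⇒x≡y v (S⊆ k∈S)) k∈S) v∉S) ⊥⊆)

    down : ∀ {S T} → S ⊆ T → GraphSimplex T → GraphSimplex S
    down S⊆T (inj₁ refl) = inj₁ (⊆-antisym S⊆T ⊥⊆)
    down S⊆T (inj₂ (inj₁ (v , refl))) = point v S⊆T
    down {S} S⊆T (inj₂ (inj₂ (u , v , uv , refl))) with u ∈? S | v ∈? S
    ... | no u∉S  | _       = point v (drop u ⁅ v ⁆ S⊆T u∉S)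
    ... | yes _   | no v∉S  = point u (drop v ⁅ u ⁆
            (λ k∈S → x∈p∪q⁺ ([ inj₂ , inj₁ ]′ (x∈p∪q⁻ ⁅ u ⁆ ⁅ v ⁆ (S⊆T k∈S)))) v∉S)
    ... | yes u∈S | yes v∈S = inj₂ (inj₂ (u , v , uv , ⊆-antisym S⊆T
            (λ k∈ → [ ⁅⁆⊆ u∈S , ⁅⁆⊆ v∈S ]′ (x∈p∪q⁻ ⁅ u ⁆ ⁅ v ⁆ k∈))))

IsSpanningTree : ∀ {n} → Complex n → Set₁
IsSpanningTree {n} K = Σ (Graph n) λ G → IsTree G × K ≐ᶜ graphComplex G

{-# OPTIONS --safe #-}
module Submission where

-- Read relative to an alternating word, Eq becomes the language of nonconstant
-- words over two letters. Its restriction to any proper set of positions contains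
-- both constant words, so no generating function splits into two independent parts:
-- the 1-skeleton of a generating complex is connected. Conversely a connected graph
-- generates the language: along a rooted tree, every vertex promises its parent that
-- its subtree contains some letter, and is free to output anything once a child has
-- promised that letter. So the minimal generating complexes are the
-- minimal connected graphs.

open import Defs
open import Data.Bool using (Bool; true; false; not; _xor_; if_then_else_)
open import Data.Bool.Properties
  using (not-injective; not-¬; ¬-not; not-involutive; xor-assoc; xor-same; xor-identityʳ)
  renaming (_≟_ to _≟ᵇ_)
open import Data.Fin using (Fin; zero; suc; toℕ; inject₁)
open import Data.Fin.Induction using (<-weakInduction)
open import Data.Fin.Properties using (any?; toℕ-inject₁; 2↔Bool) renaming (_≟_ to _≟ᶠ_)
open import Data.Fin.Subset using (Subset; _∈_; _∉_; _⊆_; _⊃_; _∪_; ⁅_⁆; ∁)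
open import Data.Fin.Subset.Induction using (⊃-wellFounded)
open import Data.Fin.Subset.Properties
  using (_∈?_; ∉⊥; ∪-comm; p⊆p∪q; q⊆p∪q; x∈⁅x⁆; x∈⁅y⁆⇒x≡y; x∈p∪q⁻; x∈∁p⇒x∉p; x∉p⇒x∈∁p)
open import Data.List using (List; []; _∷_; _++_; iterate)
open import Data.List.Membership.DecPropositional using () renaming (_∈?_ to member?)
open import Data.List.Membership.Propositional using () renaming (_∈_ to _∈ˡ_)
open import Data.List.Relation.Unary.All using (All; []; _∷_)
open import Data.List.Relation.Unary.All.Properties using (¬Any⇒All¬)
open import Data.List.Relation.Unary.AllPairs using ([]; _∷_)
open import Data.List.Relation.Unary.Any using (here; there)
open import Data.List.Relation.Unary.Linked using (Linked; [-]; _∷_)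
import Data.List.Relation.Unary.Linked as Linked
open import Data.List.Relation.Unary.Unique.Propositional using (Unique)
open import Data.Nat using (ℕ; zero; suc; _≤_; _≥_; z≤n; s≤s; _⊔_)
open import Data.Nat.Properties using (≤-trans; m≤m⊔n; m≤n⊔m; ≮⇒≥) renaming (_≟_ to _≟ⁿ_)
open import Data.Empty using (⊥; ⊥-elim)
open import Data.Product using (∃; ∃₂; _×_; _,_; proj₁; proj₂)
open import Data.Sum using (_⊎_; inj₁; inj₂)
open import Data.Vec using (Vec; lookup; tabulate)
open import Data.Vec.Properties using (lookup∘tabulate; tabulate∘lookup; tabulate-cong)
open import Function using (_∘_)
open import Function.Bundles using (_↔_; _⇔_; mk⇔; Injection; Inverse; Equivalence)
open import Function.Properties.Inverse using (↔⇒↣; ↔-trans)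
open import Induction.WellFounded using (Acc; acc)
open import Relation.Binary.Construct.Closure.ReflexiveTransitive using (Star; ε; _◅_; _◅◅_)
import Relation.Binary.Construct.Closure.ReflexiveTransitive as Star
open import Relation.Binary.PropositionalEquality
  using (_≡_; _≢_; refl; sym; trans; cong; cong₂; subst; ≢-sym; module ≡-Reasoning)
open import Relation.Nullary using (¬_; Dec; yes; no; does; contradiction)
open import Relation.Nullary.Decidable
  using (map′; ¬?; _×-dec_; _⊎-dec_; decidable-stable; dec-true; dec-false; does-⇔)

-- Walks towards a root

module _ {n : ℕ} (G : Graph n) (r : Fin n) where
  open Graph G

  data Within : ℕ → Fin n → Set where
    root : ∀ {k} → Within k r
    step : ∀ {k v w} → Edge v w → Within k w → Within (suc k) v

  within-mono : ∀ {k l v} → k ≤ l → Within k v → Within l v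
  within-mono _         root       = root
  within-mono (s≤s k≤l) (step e t) = step e (within-mono k≤l t)

  within? : ∀ k v → Dec (Within k v)
  within? zero    v = map′ (λ { refl → root }) (λ { root → refl }) (v ≟ᶠ r)
  within? (suc k) v = map′
    (λ { (inj₁ refl) → root ; (inj₂ (w , e , t)) → step e t })
    (λ { root → inj₁ refl ; (step e t) → inj₂ (_ , e , t) })
    ((v ≟ᶠ r) ⊎-dec any? λ w → edge? v w ×-dec within? k w)

  star⇒within : ∀ {v} → Star Edge v r → ∃ λ k → Within k v
  star⇒within ε       = zero , root
  star⇒within (e ◅ s) with k , t ← star⇒within s = suc k , step e t

  -- A threshold separating the two vertices expresses that the distance to `r` drops, without
  -- computing distances.
  CloserNeighbour : Fin n → Fin n → Set
  CloserNeighbour v w = Edge v w × ∃ λ k → ¬ Within k v × Within k w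

  -- Lower the bound as long as `v` stays within it. At the least bound, the first step of the walk
  -- leads to a vertex that is closer.
  closerNeighbour : ∀ {v} k → v ≢ r → Within k v → ∃ (CloserNeighbour v)
  closerNeighbour {v} k v≢r root = contradiction refl v≢r
  closerNeighbour {v} (suc k) v≢r (step e t) with within? k v
  ... | yes t′ = closerNeighbour k v≢r t′
  ... | no ¬t  = _ , e , k , ¬t , t

iter : {X : Set} → (X → X) → ℕ → X → X
iter p zero    v = v
iter p (suc k) v = iter p k (p v)

iter-suc : ∀ {X : Set} (p : X → X) k v → p (iter p k v) ≡ iter p (suc k) v
iter-suc p zero    v = refl
iter-suc p (suc k) v = iter-suc p k (p v)

upperBound : ∀ {n} (h : Fin n → ℕ) → ∃ λ N → ∀ i → h i ≤ N
upperBound {zero}  h = 0 , λ ()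
upperBound {suc n} h with N , h≤N ← upperBound (h ∘ suc) =
  h zero ⊔ N , λ { zero    → m≤m⊔n (h zero) N
                 ; (suc i) → ≤-trans (h≤N i) (m≤n⊔m (h zero) N) }

-- A rooted spanning tree, encoded by iteration. As the root is its own parent, one `height` can
-- serve all vertices at once.
record ParentMap {n : ℕ} (G : Graph n) (r : Fin n) : Set where
  field
    parent       : Fin n → Fin n
    parent-root  : parent r ≡ r
    parent-edge  : ∀ {v} → v ≢ r → Graph.Edge G v (parent v)
    height       : ℕ
    reaches-root : ∀ v → iter parent height v ≡ r

connected⇒parentMap : ∀ {n} (G : Graph n) r → Connected G → ParentMap G r
connected⇒parentMap {n} G r conn = record
  { parent       = parent
  ; parent-root  = parent-root
  ; parent-edge  = proj₁ ∘ parent-closer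
  ; height       = proj₁ bound
  ; reaches-root = λ v → descend _ (within-mono G r (proj₂ bound v) (proj₂ (walk v)))
  }
  where
  walk : ∀ v → ∃ λ k → Within G r k v
  walk v = star⇒within G r (conn v r)

  bound : ∃ λ N → ∀ v → proj₁ (walk v) ≤ N
  bound = upperBound (proj₁ ∘ walk)

  choose : ∀ v → Dec (v ≡ r) → Fin n
  choose v (yes _)  = r
  choose v (no v≢r) = proj₁ (closerNeighbour G r (proj₁ (walk v)) v≢r (proj₂ (walk v)))

  parent : Fin n → Fin n
  parent v = choose v (v ≟ᶠ r)

  parent-root : parent r ≡ r
  parent-root with r ≟ᶠ r
  ... | yes _  = refl
  ... | no r≢r = contradiction refl r≢r

  parent-closer : ∀ {v} → v ≢ r → CloserNeighbour G r v (parent v)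
  parent-closer {v} v≢r with v ≟ᶠ r
  ... | yes v≡r = contradiction v≡r v≢r
  ... | no  v≢r = proj₂ (closerNeighbour G r (proj₁ (walk v)) v≢r (proj₂ (walk v)))

  -- The threshold `l` chosen for `v` excludes `v`, while `suc k` does not, so `l ≤ k`. Hence every
  -- valid bound drops by one, not only the bound used in the choice.
  parent-within : ∀ {k v} → Within G r (suc k) v → Within G r k (parent v)
  parent-within {k} {v} t with v ≟ᶠ r
  ... | yes _ = root
  ... | no v≢r with _ , l , ¬t , t′ ← proj₂ (closerNeighbour G r (proj₁ (walk v)) v≢r (proj₂ (walk v))) =
    within-mono G r (≮⇒≥ λ k<l → ¬t (within-mono G r k<l t)) t′

  descend : ∀ k {v} → Within G r k v → iter parent k v ≡ r
  descend zero    root = refl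
  descend (suc k) t    = descend k (parent-within t)

-- Each vertex c carries a claim m c and a letter s c. The word output below is
-- arranged so that the subtree hanging from c ≢ r always contains the letter m c,
-- and the whole tree contains both letters: the child d₀ of the root provides
-- m d₀, and the root sets itself the opposite goal.
module ForcedOutput {n : ℕ} {G : Graph n} {r : Fin n} (P : ParentMap G r)
                    {other : Fin n} (other≢r : other ≢ r) where
  open ParentMap P

  Child : Fin n → Fin n → Set
  Child d c = d ≢ r × parent d ≡ c

  child? : ∀ d c → Dec (Child d c)
  child? d c = ¬? (d ≟ᶠ r) ×-dec (parent d ≟ᶠ c)

  path : Fin n → List (Fin n)
  path v = iterate parent v height

  path-pred : ∀ {c} k v → c ∈ˡ iterate parent v k →
    c ≡ v ⊎ ∃ λ d → d ∈ˡ iterate parent v k × parent d ≡ c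
  path-pred (suc k) v (here c≡v) = inj₁ c≡v
  path-pred (suc k) v (there c∈) with path-pred k (parent v) c∈
  ... | inj₁ c≡pv          = inj₂ (v , here refl , sym c≡pv)
  ... | inj₂ (d , d∈ , eq) = inj₂ (d , there d∈ , eq)

  -- The walk starts off the root and ends on it, so some step enters the root. The source of that
  -- step is listed, since the list holds all iterates before the `k`-th.
  path-last : ∀ k v → v ≢ r → iter parent k v ≡ r → ∃ λ d → d ∈ˡ iterate parent v k × Child d r
  path-last zero    v v≢r eq = contradiction eq v≢r
  path-last (suc k) v v≢r eq with parent v ≟ᶠ r
  ... | yes pv≡r = v , here refl , v≢r , pv≡r
  ... | no  pv≢r with d , d∈ , ch ← path-last k (parent v) pv≢r eq = d , there d∈ , ch

  d₀ : Fin n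
  d₀ = proj₁ (path-last height other other≢r (reaches-root other))

  d₀-child : Child d₀ r
  d₀-child = proj₂ (proj₂ (path-last height other other≢r (reaches-root other)))

  module _ (m : Fin n → Bool) where

    goal : Fin n → Bool
    goal c = if does (c ≟ᶠ r) then not (m d₀) else m c

    goal-root : goal r ≡ not (m d₀)
    goal-root = cong (λ b → if b then not (m d₀) else m r) (dec-true (r ≟ᶠ r) refl)

    goal-nonroot : ∀ {c} → c ≢ r → goal c ≡ m c
    goal-nonroot {c} c≢r = cong (λ b → if b then not (m d₀) else m c) (dec-false (c ≟ᶠ r) c≢r)

    Met : Fin n → Set
    Met c = ∃ λ d → Child d c × m d ≡ goal c

    met? : ∀ c → Dec (Met c)
    met? c = any? λ d → child? d c ×-dec (m d ≟ᵇ goal c)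

    output : (Fin n → Bool) → Fin n → Bool
    output s c = if does (met? c) then s c else goal c

    module _ (s : Fin n → Bool) where

      output-cases : ∀ c → output s c ≡ goal c ⊎ Met c
      output-cases c with met? c
      ... | yes met = inj₂ met
      ... | no  _   = inj₁ refl

      output-fixed : ∀ c → s c ≡ goal c ⊎ Met c → output s c ≡ s c
      output-fixed c h with met? c | h
      ... | yes _   | _         = refl
      ... | no  _   | inj₁ eq   = sym eq
      ... | no ¬met | inj₂ met  = contradiction met ¬met

      -- The hypothesis bounds the depth of the subtree below `c`. If `c` does not output its goal,
      -- some child claims that letter, and the search goes on below the child with depth one less.
      goal-attained-below : ∀ k c → (∀ d → iter parent k d ≢ c) → ∃ λ e → output s e ≡ goal c
      goal-attained-below zero    c h = contradiction refl (h c)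
      goal-attained-below (suc k) c h with output-cases c
      ... | inj₁ eq = c , eq
      ... | inj₂ (d , (d≢r , pd≡c) , md≡)
        with e , eq ← goal-attained-below k d
               (λ e e≡d → h e (trans (sym (iter-suc parent k e)) (trans (cong parent e≡d) pd≡c)))
        = e , trans eq (trans (goal-nonroot d≢r) md≡)

      claim-attained : ∀ {c} → c ≢ r → ∃ λ e → output s e ≡ m c
      claim-attained {c} c≢r
        -- After `height` steps every vertex is at the root, hence none is at `c`.
        with e , eq ← goal-attained-below height c (λ d eq → c≢r (trans (sym eq) (reaches-root d)))
        = e , trans eq (goal-nonroot c≢r)

      -- The depth bound is never satisfied at the root, which is its own parent. One level is
      -- therefore unfolded by hand.
      root-goal-attained : ∃ λ e → output s e ≡ goal r
      root-goal-attained with output-cases r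
      ... | inj₁ eq = r , eq
      ... | inj₂ (d , (d≢r , _) , md≡) with e , eq ← claim-attained d≢r = e , trans eq md≡

      output-nonconstant : ∃₂ λ u v → output s u ≢ output s v
      output-nonconstant
        with u , eq₁ ← claim-attained (proj₁ d₀-child) | v , eq₂ ← root-goal-attained
        = u , v , λ eq → not-¬ {m d₀} refl (trans (sym eq₁) (trans eq (trans eq₂ goal-root)))

  -- This later bounds the input windows. The goal of the root reads `m d₀`, which is local because
  -- `d₀` is a child of the root.
  output-local : ∀ {m m′ s s′ : Fin n → Bool} c →
    (∀ d → d ≡ c ⊎ Child d c → m d ≡ m′ d × s d ≡ s′ d) →
    output m s c ≡ output m′ s′ c
  output-local {m} {m′} {s} {s′} c agree = cond
    (does-⇔ (mk⇔ (met⇒met agree goal≡)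
                  (met⇒met (λ d near → sym (proj₁ (agree d near)) , sym (proj₂ (agree d near)))
                           (sym goal≡)))
             (met? m c) (met? m′ c))
    (proj₂ (agree c (inj₁ refl))) goal≡
    where
    cond : ∀ {b b′ x x′ y y′ : Bool} → b ≡ b′ → x ≡ x′ → y ≡ y′ →
      (if b then x else y) ≡ (if b′ then x′ else y′)
    cond refl refl refl = refl

    goal≡ : goal m c ≡ goal m′ c
    goal≡ with c ≟ᶠ r
    ... | yes refl = cong not (proj₁ (agree d₀ (inj₂ d₀-child)))
    ... | no  _    = proj₁ (agree c (inj₁ refl))

    met⇒met : ∀ {m m′ s s′ : Fin n → Bool} →
      (∀ d → d ≡ c ⊎ Child d c → m d ≡ m′ d × s d ≡ s′ d) →
      goal m c ≡ goal m′ c → Met m c → Met m′ c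
    met⇒met agree goal≡ (d , ch , eq) =
      d , ch , trans (sym (proj₁ (agree d (inj₂ ch)))) (trans eq goal≡)

  -- Claim the letter g v opposite to g r along the path from v to the root, and
  -- one's own letter elsewhere.
  nonconstant⇒output : ∀ (g : Fin n → Bool) {v} → g v ≢ g r → ∃ λ m → ∀ c → output m g c ≡ g c
  nonconstant⇒output g {v} gv≢gr = m , λ c → output-fixed m g c (fixed c)
    where
    claim : ∀ c → Dec (c ∈ˡ path v) → Bool
    claim c (yes _) = g v
    claim c (no _)  = g c

    m : Fin n → Bool
    m c = claim c (member? _≟ᶠ_ c (path v))

    m-on-path : ∀ {c} → c ∈ˡ path v → m c ≡ g v
    m-on-path {c} c∈ with member? _≟ᶠ_ c (path v)
    ... | yes _ = refl
    ... | no c∉ = contradiction c∈ c∉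

    -- Off the path, and at `v` itself, the claim is the vertex's own letter. Further along the
    -- path, the preceding vertex is a child with the same claim.
    fixed-nonroot : ∀ {c} → c ≢ r → g c ≡ m c ⊎ ∃ λ d → Child d c × m d ≡ m c
    fixed-nonroot {c} c≢r with member? _≟ᶠ_ c (path v)
    ... | no _   = inj₁ refl
    ... | yes c∈ with path-pred height v c∈
    ...   | inj₁ c≡v            = inj₁ (cong g c≡v)
    ...   | inj₂ (d , d∈ , pd≡c) = inj₂ (d , (d≢r , pd≡c) , m-on-path d∈)
      where
      d≢r : d ≢ r
      d≢r d≡r = c≢r (trans (sym pd≡c) (trans (cong parent d≡r) parent-root))

    fixed : ∀ c → g c ≡ goal m c ⊎ Met m c
    fixed c with c ≟ᶠ r
    ... | no c≢r = fixed-nonroot c≢r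
    -- If `d₀` claims `g v`, the root's goal is its own letter. Otherwise its goal is `g v`, claimed
    -- by the last non-root vertex of the path.
    ... | yes refl with m d₀ ≟ᵇ g v
    ...   | yes eq = inj₁ (trans (¬-not (≢-sym gv≢gr)) (cong not (sym eq)))
    ...   | no neq with d , d∈ , ch ← path-last height v (gv≢gr ∘ cong g) (reaches-root v) =
      inj₂ (d , ch , trans (m-on-path d∈) (¬-not (≢-sym neq)))

-- Recoding words by the alternating word

odd : ℕ → Bool
odd zero    = false
odd (suc k) = not (odd k)

xor-cancelʳ : ∀ a b → (a xor b) xor b ≡ a
xor-cancelʳ a b = trans (xor-assoc a b b) (trans (cong (a xor_) (xor-same b)) (xor-identityʳ a))

xor-not : ∀ a b → a xor b ≢ a xor not b
xor-not false false ()
xor-not false true  ()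
xor-not true  false ()
xor-not true  true  ()

xor-injectiveˡ : ∀ a b c → a xor c ≢ b xor not c → a ≡ b
xor-injectiveˡ false false c neq = refl
xor-injectiveˡ true  true  c neq = refl
xor-injectiveˡ false true  c neq = contradiction (sym (not-involutive c)) neq
xor-injectiveˡ true  false c neq = contradiction refl neq

Consecutive : ∀ {n} → Fin n → Fin n → Set
Consecutive i i′ = toℕ i′ ≡ suc (toℕ i)

-- Without a change between neighbours, induction from `zero` would make `g` constant.
consecutive-change : ∀ {n} (g : Fin n → Bool) {u v} → g u ≢ g v →
  ∃₂ λ i i′ → Consecutive i i′ × g i ≢ g i′
consecutive-change {suc n} g {u} {v} gu≢gv
  with any? (λ i → any? λ i′ → (toℕ i′ ≟ⁿ suc (toℕ i)) ×-dec ¬? (g i ≟ᵇ g i′))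
... | yes change = change
... | no ¬change = contradiction (trans (constant u) (sym (constant v))) gu≢gv
  where
  constant : ∀ i → g i ≡ g zero
  constant = <-weakInduction _ refl λ i eq →
    trans (sym (decidable-stable (g (inject₁ i) ≟ᵇ g (suc i)) λ neq →
      ¬change (inject₁ i , suc i , cong suc (sym (toℕ-inject₁ i)) , neq))) eq

module _ {A : Set} (A↔2 : A ↔ Fin 2) where

  private
    module A↔Bool = Inverse (↔-trans A↔2 2↔Bool)

  letter : ∀ {n} → Fin n → Bool → A
  letter i b = A↔Bool.from (b xor odd (toℕ i))

  word : ∀ {n} → (Fin n → Bool) → Vec A n
  word g = tabulate λ i → letter i (g i)

  -- Comparison with the alternating word: two neighbouring letters of `w` are equal exactly where
  -- the phase changes.
  phase : ∀ {n} → Vec A n → Fin n → Bool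
  phase w i = A↔Bool.to (lookup w i) xor odd (toℕ i)

  phase-word : ∀ {n} (g : Fin n → Bool) i → phase (word g) i ≡ g i
  phase-word g i = begin
    phase (word g) i
      ≡⟨ cong (λ a → A↔Bool.to a xor odd (toℕ i)) (lookup∘tabulate _ i) ⟩
    A↔Bool.to (letter i (g i)) xor odd (toℕ i)
      ≡⟨ cong (_xor odd (toℕ i)) (A↔Bool.strictlyInverseˡ _) ⟩
    (g i xor odd (toℕ i)) xor odd (toℕ i)
      ≡⟨ xor-cancelʳ (g i) _ ⟩
    g i ∎
    where open ≡-Reasoning

  word-phase : ∀ {n} (w : Vec A n) {g} → (∀ i → g i ≡ phase w i) → word g ≡ w
  word-phase w {g} g≡ = trans (tabulate-cong λ i → begin
    letter i (g i)
      ≡⟨ cong (letter i) (g≡ i) ⟩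
    letter i (phase w i)
      ≡⟨ cong A↔Bool.from (xor-cancelʳ (A↔Bool.to (lookup w i)) _) ⟩
    A↔Bool.from (A↔Bool.to (lookup w i))
      ≡⟨ A↔Bool.strictlyInverseʳ _ ⟩
    lookup w i ∎) (tabulate∘lookup w)
    where open ≡-Reasoning

  Eq⇒nonconstant : ∀ {n} (w : Vec A n) → Eq A n w → ∃₂ λ u v → phase w u ≢ phase w v
  Eq⇒nonconstant w (i , i′ , next , same) = i , i′ , λ eq → xor-not
    (A↔Bool.to (lookup w i)) (odd (toℕ i))
    (trans eq (cong₂ _xor_ (cong A↔Bool.to (sym same)) (cong odd next)))

  nonconstant⇒Eq : ∀ {n} (w : Vec A n) u v → phase w u ≢ phase w v → Eq A n w
  nonconstant⇒Eq w u v neq with i , i′ , next , change ← consecutive-change (phase w) {u} {v} neq =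
    i , i′ , next , Injection.injective (↔⇒↣ (↔-trans A↔2 2↔Bool)) (xor-injectiveˡ _ _ (odd (toℕ i)) λ eq →
      change (trans eq (cong (λ k → A↔Bool.to (lookup w i′) xor odd k) (sym next))))

  word-Eq : ∀ {n} (g : Fin n → Bool) u v → g u ≢ g v → Eq A n (word g)
  word-Eq g u v neq = nonconstant⇒Eq (word g) u v λ eq →
    neq (trans (sym (phase-word g u)) (trans eq (phase-word g v)))

-- Pairs of a claim and a letter coded by four symbols

claim letterOf : Fin 4 → Bool
claim zero                       = false
claim (suc zero)                 = false
claim (suc (suc _))              = true
letterOf zero                    = false
letterOf (suc zero)              = true
letterOf (suc (suc zero))        = false
letterOf (suc (suc (suc zero)))  = true

message : Bool → Bool → Fin 4
message false false = zero
message false true  = suc zero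
message true  false = suc (suc zero)
message true  true  = suc (suc (suc zero))

claim-message : ∀ m s → claim (message m s) ≡ m
claim-message false false = refl
claim-message false true  = refl
claim-message true  false = refl
claim-message true  true  = refl

letterOf-message : ∀ m s → letterOf (message m s) ≡ s
letterOf-message false false = refl
letterOf-message false true  = refl
letterOf-message true  false = refl
letterOf-message true  true  = refl

-- Generation by connected graphs, and why disjoint windows fail

module _ {A : Set} (A↔2 : A ↔ Fin 2) where

  generates-mono : ∀ {n} {K K′ : Complex n} {L : Language A n} →
    K ⊆ᶜ K′ → Generates A↔2 K L → Generates A↔2 K′ L
  generates-mono K⊆K′ (b , j , f , img , f⊆K) = b , j , f , img , λ {S} z → K⊆K′ (f⊆K {S} z)

  -- Each vertex owns one input cell, holding its claim and its free letter. A cell is read at most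
  -- by its owner and the owner's parent, so the simplices of the communication complex are at most
  -- edges of the graph.
  connected⇒generates : ∀ {n} (G : Graph n) {r other : Fin n} → other ≢ r → Connected G →
    Generates A↔2 (graphComplex G) (Eq A n)
  connected⇒generates {n} G {r} other≢r conn = 4 , n , f , image , complex⊆
    where
    P = connected⇒parentMap G r conn
    open ParentMap P using (parent-edge; parent)
    open ForcedOutput P other≢r

    claims letters : Vec (Fin 4) n → Fin n → Bool
    claims  x c = claim (lookup x c)
    letters x c = letterOf (lookup x c)

    f : Vec (Fin 4) n → Vec A n
    f x = word A↔2 (output (claims x) (letters x))

    image : HasImage A↔2 f (Eq A n)
    image w = mk⇔ surjective λ { (x , refl) →
      let u , v , neq = output-nonconstant (claims x) (letters x)
      in word-Eq A↔2 (output (claims x) (letters x)) u v neq }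
      where
      preimage : (∃₂ λ u v → phase A↔2 w u ≢ phase A↔2 w v) →
        ∃ λ m → ∀ c → output m (phase A↔2 w) c ≡ phase A↔2 w c
      -- The path of claims must start at a vertex whose phase differs from that of the root; one of
      -- `u` and `v` qualifies.
      preimage (u , v , neq) with phase A↔2 w u ≟ᵇ phase A↔2 w r
      ... | no u≢  = nonconstant⇒output _ u≢
      ... | yes u≡ = nonconstant⇒output _ (λ v≡ → neq (trans u≡ (sym v≡)))

      surjective : Eq A n w → ∃ λ x → f x ≡ w
      surjective eq with m , out≡ ← preimage (Eq⇒nonconstant A↔2 w eq) =
        tabulate (λ c → message (m c) (phase A↔2 w c)) ,
        word-phase A↔2 w λ c → trans (output-local c λ d _ →
          trans (cong claim (lookup∘tabulate _ d)) (claim-message _ _) ,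
          trans (cong letterOf (lookup∘tabulate _ d)) (letterOf-message _ _)) (out≡ c)

    -- Otherwise changing cell `k` alone cannot affect position `i`, so the complement of `k`
    -- determines it and contains the window.
    window-near : ∀ {i k} → k ∈ inputWindow A↔2 f i → k ≡ i ⊎ Child k i
    window-near {i} {k} k∈W = decidable-stable ((k ≟ᶠ i) ⊎-dec child? k i) λ far →
      x∈∁p⇒x∉p (proj₂ (isInputWindow A↔2 f i) (∁ ⁅ k ⁆) (local far) k∈W) (x∈⁅x⁆ k)
      where
      local : ¬ (k ≡ i ⊎ Child k i) → Determines f i (∁ ⁅ k ⁆)
      local far x y x≈y = trans (lookup∘tabulate _ i) (trans
        (cong (letter A↔2 i) (output-local i λ d near →
          let d≈ = x≈y d (x∉p⇒x∈∁p λ d∈ →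
                     far (subst (λ l → l ≡ i ⊎ Child l i) (x∈⁅y⁆⇒x≡y k d∈) near))
          in cong claim d≈ , cong letterOf d≈))
        (sym (lookup∘tabulate _ i)))

    -- The root is split off: it has no edge to its parent, but its cell is read by the root alone.
    near-simplex : ∀ {S} k → (∀ i → i ∈ S → k ≡ i ⊎ Child k i) → Dec (k ≡ r) → GraphSimplex G S
    near-simplex {S} k near (yes k≡r) =
      Complex.down (graphComplex G) S⊆ (inj₂ (inj₁ (k , refl)))
      where
      S⊆ : S ⊆ ⁅ k ⁆
      S⊆ {i} i∈S with near i i∈S
      ... | inj₁ refl      = x∈⁅x⁆ k
      ... | inj₂ (k≢r , _) = contradiction k≡r k≢r
    near-simplex {S} k near (no k≢r) =
      Complex.down (graphComplex G) S⊆ (inj₂ (inj₂ (k , parent k , parent-edge k≢r , refl)))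
      where
      S⊆ : S ⊆ ⁅ k ⁆ ∪ ⁅ parent k ⁆
      S⊆ {i} i∈S with near i i∈S
      ... | inj₁ refl       = p⊆p∪q ⁅ parent k ⁆ (x∈⁅x⁆ k)
      ... | inj₂ (_ , refl) = q⊆p∪q ⁅ k ⁆ ⁅ parent k ⁆ (x∈⁅x⁆ (parent k))

    complex⊆ : communicationComplex A↔2 f ⊆ᶜ graphComplex G
    complex⊆ {S} (inj₁ S-empty) =
      Complex.down (graphComplex G) (λ {x} x∈S → contradiction (x , x∈S) S-empty)
        (Complex.empty (graphComplex G))
    complex⊆ {S} (inj₂ (k , k∈W)) = near-simplex k (λ i i∈S → window-near (k∈W i i∈S)) (k ≟ᶠ r)

  -- Mixing an input producing one half of the alternating word with an input
  -- producing the other half would produce the alternating word itself.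
  windows-cross : ∀ {b j n} (f : Vec (Fin b) j → Vec A n) → HasImage A↔2 f (Eq A n) →
    (W : Fin n → Subset j) → (∀ i → Determines f i (W i)) →
    (C : Subset n) → ∀ {u v} → u ∈ C → v ∉ C →
    (∀ {i i′ k} → i ∈ C → i′ ∉ C → k ∈ W i → k ∈ W i′ → ⊥) → ⊥
  windows-cross {b} {j} {n} f image W determines C {u} {v} u∈C v∉C disjoint
    = fz-constant (Eq⇒nonconstant A↔2 (f z) (Equivalence.from (image (f z)) (z , refl)))
    where
    inC : Fin n → Bool
    inC i = does (i ∈? C)

    change : inC u ≢ inC v
    change eq with () ← trans (sym (dec-true (u ∈? C) u∈C)) (trans eq (dec-false (v ∈? C) v∉C))

    input₁ : ∃ λ x → f x ≡ word A↔2 inC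
    input₁ = Equivalence.to (image _) (word-Eq A↔2 inC u v change)

    input₂ : ∃ λ x → f x ≡ word A↔2 (not ∘ inC)
    input₂ = Equivalence.to (image _) (word-Eq A↔2 (not ∘ inC) u v (change ∘ not-injective))

    Seen : Fin j → Set
    Seen k = ∃ λ i → i ∈ C × k ∈ W i

    seen? : ∀ k → Dec (Seen k)
    seen? k = any? λ i → (i ∈? C) ×-dec (k ∈? W i)

    -- Cells read from within `C` come from the first input, all others from the second. By
    -- disjointness, positions outside `C` see only the second.
    mix : Fin j → Fin b
    mix k = if does (seen? k) then lookup (proj₁ input₁) k else lookup (proj₁ input₂) k

    z : Vec (Fin b) j
    z = tabulate mix

    phase-agree : ∀ i x g → f x ≡ word A↔2 g → AgreeOn f i (W i) z x →
      phase A↔2 (f z) i ≡ g i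
    phase-agree i x g fx≡ z≈x = trans
      (cong (λ a → Inverse.to (↔-trans A↔2 2↔Bool) a xor odd (toℕ i))
        (trans (determines i z x z≈x) (cong (λ w → lookup w i) fx≡)))
      (phase-word A↔2 g i)

    z≈₁ : ∀ {i} → i ∈ C → AgreeOn f i (W i) z (proj₁ input₁)
    z≈₁ i∈C k k∈W = trans (lookup∘tabulate mix k)
      (cong (λ c → if c then lookup (proj₁ input₁) k else lookup (proj₁ input₂) k)
        (dec-true (seen? k) (_ , i∈C , k∈W)))

    z≈₂ : ∀ {i} → i ∉ C → AgreeOn f i (W i) z (proj₁ input₂)
    z≈₂ i∉C k k∈W = trans (lookup∘tabulate mix k)
      (cong (λ c → if c then lookup (proj₁ input₁) k else lookup (proj₁ input₂) k)
        (dec-false (seen? k) λ { (_ , i∈C , k∈W′) → disjoint i∈C i∉C k∈W′ k∈W }))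

    phase-z : ∀ i → phase A↔2 (f z) i ≡ true
    phase-z i = half (i ∈? C)
      where
      half : Dec (i ∈ C) → phase A↔2 (f z) i ≡ true
      half (yes i∈C) = trans (phase-agree i _ inC (proj₂ input₁) (z≈₁ i∈C))
                             (dec-true (i ∈? C) i∈C)
      half (no i∉C)  = trans (phase-agree i _ (not ∘ inC) (proj₂ input₂) (z≈₂ i∉C))
                             (cong not (dec-false (i ∈? C) i∉C))

    fz-constant : ¬ (∃₂ λ p q → phase A↔2 (f z) p ≢ phase A↔2 (f z) q)
    fz-constant (p , q , neq) = neq (trans (phase-z p) (sym (phase-z q)))

-- The 1-skeleton of a complex

module _ {n : ℕ} where

  ⁅⁆⊆ : ∀ {v : Fin n} {S} → v ∈ S → ⁅ v ⁆ ⊆ S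
  ⁅⁆⊆ {v} {S} v∈S k∈ = subst (_∈ S) (sym (x∈⁅y⁆⇒x≡y v k∈)) v∈S

  ∈-pair : ∀ {u v x : Fin n} → x ∈ ⁅ u ⁆ ∪ ⁅ v ⁆ → x ≡ u ⊎ x ≡ v
  ∈-pair {u} {v} x∈ with x∈p∪q⁻ ⁅ u ⁆ ⁅ v ⁆ x∈
  ... | inj₁ x∈u = inj₁ (x∈⁅y⁆⇒x≡y u x∈u)
  ... | inj₂ x∈v = inj₂ (x∈⁅y⁆⇒x≡y v x∈v)

  left∈pair : ∀ (u v : Fin n) → u ∈ ⁅ u ⁆ ∪ ⁅ v ⁆
  left∈pair u v = p⊆p∪q ⁅ v ⁆ (x∈⁅x⁆ u)

  right∈pair : ∀ (u v : Fin n) → v ∈ ⁅ u ⁆ ∪ ⁅ v ⁆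
  right∈pair u v = q⊆p∪q ⁅ u ⁆ ⁅ v ⁆ (x∈⁅x⁆ v)

  pair-simplex⇒edge : ∀ (G : Graph n) {u v} → u ≢ v →
    GraphSimplex G (⁅ u ⁆ ∪ ⁅ v ⁆) → Graph.Edge G u v
  pair-simplex⇒edge G {u} {v} u≢v (inj₁ eq) =
    contradiction (subst (u ∈_) eq (left∈pair u v)) ∉⊥
  pair-simplex⇒edge G {u} {v} u≢v (inj₂ (inj₁ (x , eq))) = contradiction
    (trans (x∈⁅y⁆⇒x≡y x (subst (u ∈_) eq (left∈pair u v)))
           (sym (x∈⁅y⁆⇒x≡y x (subst (v ∈_) eq (right∈pair u v))))) u≢v
  pair-simplex⇒edge G {u} {v} u≢v (inj₂ (inj₂ (x , y , e , eq)))
    with ∈-pair (subst (u ∈_) eq (left∈pair u v)) | ∈-pair (subst (v ∈_) eq (right∈pair u v))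
  ... | inj₁ refl | inj₁ v≡u  = contradiction (sym v≡u) u≢v
  ... | inj₁ refl | inj₂ refl = e
  ... | inj₂ refl | inj₁ refl = Graph.symm G e
  ... | inj₂ refl | inj₂ v≡u  = contradiction (sym v≡u) u≢v

  -- Distinctness is demanded because the union of two equal singletons is a vertex and would yield
  -- a loop.
  skeleton : Complex n → Graph n
  skeleton K = record
    { Edge   = λ u v → u ≢ v × Simplex K (⁅ u ⁆ ∪ ⁅ v ⁆)
    ; edge?  = λ u v → ¬? (u ≟ᶠ v) ×-dec Complex.simplex? K (⁅ u ⁆ ∪ ⁅ v ⁆)
    ; symm   = λ {u} {v} (u≢v , uv) → ≢-sym u≢v , subst (Simplex K) (∪-comm ⁅ u ⁆ ⁅ v ⁆) uv
    ; irrefl = λ v (v≢v , _) → v≢v refl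
    }

  -- A complex may omit singletons; here a walk to another vertex starts with an edge containing
  -- `u`.
  vertex∈skeleton : ∀ K {u v} → u ≢ v → Connected (skeleton K) → Simplex K ⁅ u ⁆
  vertex∈skeleton K {u} {v} u≢v conn with conn u v
  ... | ε                          = contradiction refl u≢v
  ... | _◅_ {j = w} (_ , uw) _ = Complex.down K (⁅⁆⊆ (left∈pair u w)) uw

  another : ∀ {r other : Fin n} → other ≢ r → ∀ v → ∃ λ u → v ≢ u
  another {r} {other} other≢r v with v ≟ᶠ r
  ... | yes refl = other , ≢-sym other≢r
  ... | no  v≢r  = r , v≢r

  skeleton⊆ : ∀ K {r other : Fin n} → other ≢ r → Connected (skeleton K) →
    graphComplex (skeleton K) ⊆ᶜ K
  skeleton⊆ K other≢r conn (inj₁ refl)                             = Complex.empty K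
  skeleton⊆ K other≢r conn (inj₂ (inj₁ (v , refl)))                =
    vertex∈skeleton K (proj₂ (another other≢r v)) conn
  skeleton⊆ K other≢r conn (inj₂ (inj₂ (u , v , (_ , uv) , refl))) = uv

  -- Outside neighbours are added one at a time; this stops because a strictly growing chain of
  -- subsets is finite.
  component : ∀ (G : Graph n) u → ∃ λ C → u ∈ C × (∀ {v} → v ∈ C → Star (Graph.Edge G) u v) ×
    (∀ {v w} → v ∈ C → Graph.Edge G v w → w ∈ C)
  component G u = grow ⁅ u ⁆ (⊃-wellFounded ⁅ u ⁆) (x∈⁅x⁆ u)
    λ v∈ → subst (Star Edge u) (sym (x∈⁅y⁆⇒x≡y u v∈)) ε
    where
    open Graph G

    grow : ∀ C → Acc _⊃_ C → u ∈ C → (∀ {v} → v ∈ C → Star Edge u v) →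
      ∃ λ C → u ∈ C × (∀ {v} → v ∈ C → Star Edge u v) × (∀ {v w} → v ∈ C → Edge v w → w ∈ C)
    grow C (acc rec) u∈C reach
      with any? (λ v → any? λ w → (v ∈? C) ×-dec edge? v w ×-dec ¬? (w ∈? C))
    ... | no closed = C , u∈C , reach , λ {v} {w} v∈C vw →
            decidable-stable (w ∈? C) λ w∉C → closed (v , w , v∈C , vw , w∉C)
    ... | yes (v , w , v∈C , vw , w∉C) =
            grow (C ∪ ⁅ w ⁆) (rec (p⊆p∪q ⁅ w ⁆ , w , q⊆p∪q C ⁅ w ⁆ (x∈⁅x⁆ w) , w∉C))
              (p⊆p∪q ⁅ w ⁆ u∈C) reach′
      where
      reach′ : ∀ {x} → x ∈ C ∪ ⁅ w ⁆ → Star Edge u x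
      reach′ {x} x∈ with x∈p∪q⁻ C ⁅ w ⁆ x∈
      ... | inj₁ x∈C = reach x∈C
      ... | inj₂ x∈w = subst (Star Edge u) (sym (x∈⁅y⁆⇒x≡y w x∈w)) (reach v∈C ◅◅ vw ◅ ε)

-- A cell shared by a position in the component of `u` and one outside would make them a simplex,
-- hence an edge leaving the component. So no windows meet across it, which `windows-cross` refutes
-- if `v` lies outside.
generates⇒connected : ∀ {A : Set} (A↔2 : A ↔ Fin 2) {n} (K : Complex n) →
  Generates A↔2 K (Eq A n) → Connected (skeleton K)
generates⇒connected A↔2 K (b , j , f , image , f⊆K) u v
  with C , u∈C , reach , closed ← component (skeleton K) u
  with v ∈? C
... | yes v∈C = reach v∈C
... | no  v∉C = ⊥-elim (windows-cross A↔2 f image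
  (inputWindow A↔2 f) (λ i → proj₁ (isInputWindow A↔2 f i)) C u∈C v∉C disjoint)
  where
  disjoint : ∀ {i i′ k} → i ∈ C → i′ ∉ C →
    k ∈ inputWindow A↔2 f i → k ∈ inputWindow A↔2 f i′ → ⊥
  disjoint {i} {i′} {k} i∈C i′∉C k∈W k∈W′ = i′∉C (closed i∈C
    ((λ { refl → i′∉C i∈C }) , f⊆K {⁅ i ⁆ ∪ ⁅ i′ ⁆} (inj₂ (k , λ x x∈ → shared (∈-pair x∈)))))
    where
    shared : ∀ {x} → x ≡ i ⊎ x ≡ i′ → k ∈ inputWindow A↔2 f x
    shared (inj₁ refl) = k∈W
    shared (inj₂ refl) = k∈W′

-- Cycles

module _ {n : ℕ} (G : Graph n) where
  open Graph G

  simple-path-from : ∀ {u v} l → u ∈ˡ l → Linked Edge (l ++ v ∷ []) → Unique (v ∷ l) →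
    ∃ λ mid → Linked Edge (u ∷ mid ++ v ∷ []) × Unique (v ∷ u ∷ mid)
  simple-path-from (_ ∷ mid) (here refl) linked unique = mid , linked , unique
  simple-path-from (_ ∷ l)   (there u∈l) linked ((_ ∷ v∉l) ∷ (_ ∷ l!)) =
    simple-path-from l u∈l (Linked.tail linked) (v∉l ∷ l!)

  -- If `u` recurs on the path already built from the next vertex, the loop is cut off there. The
  -- endpoint `v` heads the distinctness list so that an edge from `v` to `u` closes the path into
  -- an `IsCycle`.
  simple-path : ∀ {u v} → u ≢ v → Star Edge u v →
    ∃ λ mid → Linked Edge (u ∷ mid ++ v ∷ []) × Unique (v ∷ u ∷ mid)
  simple-path u≢v ε = contradiction refl u≢v
  simple-path {u} {v} u≢v (_◅_ {j = w} uw wv) with w ≟ᶠ v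
  ... | yes refl = [] , uw ∷ [-] , (≢-sym u≢v ∷ []) ∷ [] ∷ []
  ... | no  w≢v with mid , linked , (v∉ ∷ unique) ← simple-path w≢v wv
                with member? _≟ᶠ_ u (w ∷ mid)
  ...   | yes u∈ = simple-path-from (w ∷ mid) u∈ linked (v∉ ∷ unique)
  ...   | no  u∉ = w ∷ mid , uw ∷ linked ,
                   (≢-sym u≢v ∷ v∉) ∷ ¬Any⇒All¬ (w ∷ mid) u∉ ∷ unique

  SameEdge : Fin n → Fin n → Fin n → Fin n → Set
  SameEdge u v x y = (x ≡ u × y ≡ v) ⊎ (x ≡ v × y ≡ u)

  removeEdge : Fin n → Fin n → Graph n
  removeEdge u v = record
    { Edge   = λ x y → Edge x y × ¬ SameEdge u v x y
    ; edge?  = λ x y → edge? x y ×-dec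
                 ¬? (((x ≟ᶠ u) ×-dec (y ≟ᶠ v)) ⊎-dec ((x ≟ᶠ v) ×-dec (y ≟ᶠ u)))
    ; symm   = λ (xy , ≢uv) → symm xy , λ { (inj₁ (y≡u , x≡v)) → ≢uv (inj₂ (x≡v , y≡u))
                                           ; (inj₂ (y≡v , x≡u)) → ≢uv (inj₁ (x≡u , y≡v)) }
    ; irrefl = λ v (vv , _) → irrefl v vv
    }

  removeEdge⊂ : ∀ {u v} → Edge u v → graphComplex (removeEdge u v) ⊂ᶜ graphComplex G
  removeEdge⊂ {u} {v} uv = ⊆ , λ ⊇ → proj₂
    (pair-simplex⇒edge (removeEdge u v) (λ { refl → irrefl u uv })
      (⊇ (inj₂ (inj₂ (u , v , uv , refl))))) (inj₁ (refl , refl))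
    where
    ⊆ : graphComplex (removeEdge u v) ⊆ᶜ graphComplex G
    ⊆ (inj₁ eq)                                = inj₁ eq
    ⊆ (inj₂ (inj₁ p))                          = inj₂ (inj₁ p)
    ⊆ (inj₂ (inj₂ (x , y , (xy , _) , eq)))    = inj₂ (inj₂ (x , y , xy , eq))

  -- Every step starts at a vertex other than `u` and `v`, so it is not the removed edge.
  detour : ∀ {u v} x l → All (u ≢_) (x ∷ l) → All (v ≢_) (x ∷ l) →
    Linked Edge (x ∷ l ++ u ∷ []) → Star (Graph.Edge (removeEdge u v)) x u
  detour x []      (u≢x ∷ _)  (v≢x ∷ _)  (xu ∷ _) =
    (xu , λ { (inj₁ (x≡u , _)) → u≢x (sym x≡u) ; (inj₂ (x≡v , _)) → v≢x (sym x≡v) }) ◅ ε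
  detour x (y ∷ l) (u≢x ∷ u≢) (v≢x ∷ v≢) (xy ∷ linked) =
    (xy , λ { (inj₁ (x≡u , _)) → u≢x (sym x≡u) ; (inj₂ (x≡v , _)) → v≢x (sym x≡v) })
    ◅ detour y l u≢ v≢ linked

  -- The rest of the cycle joins the ends of its first edge, so walks can be rerouted along it.
  cycle-edge-redundant : Connected G → ∀ {u us} → IsCycle G u us →
    ∃ λ v → Edge u v × Connected (removeEdge u v)
  cycle-edge-redundant conn {us = []}    (s≤s () , _)
  cycle-edge-redundant conn {us = _ ∷ []} (s≤s (s≤s ()) , _)
  cycle-edge-redundant conn {u} {v ∷ w ∷ l}
    (_ , ((u≢v ∷ u≢w ∷ u≢l) ∷ (v≢w ∷ v≢l) ∷ _) , (uv ∷ vw ∷ linked)) =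
    v , uv , λ x y → Star.concat (Star.map reroute (conn x y))
    where
    open Graph (removeEdge u v) using () renaming (Edge to Edge′; symm to symm′)

    v⇝u : Star Edge′ v u
    -- This step starts at `v`, so `detour` does not cover it; it survives because the third vertex
    -- `w` differs from `u`.
    v⇝u = (vw , λ { (inj₁ (v≡u , _)) → u≢v (sym v≡u) ; (inj₂ (_ , w≡u)) → u≢w (sym w≡u) })
      ◅ detour w l (u≢w ∷ u≢l) (v≢w ∷ v≢l) linked

    reroute : ∀ {x y} → Edge x y → Star Edge′ x y
    reroute {x} {y} xy with Graph.edge? (removeEdge u v) x y | (x ≟ᶠ u) ×-dec (y ≟ᶠ v)
                          | (x ≟ᶠ v) ×-dec (y ≟ᶠ u)
    ... | yes xy′ | _                 | _                 = xy′ ◅ ε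
    ... | no _    | yes (refl , refl) | _                 = Star.reverse symm′ v⇝u
    ... | no _    | no _              | yes (refl , refl) = v⇝u
    ... | no ¬xy′ | no ≢uv            | no ≢vu            =
      contradiction (xy , λ { (inj₁ eq) → ≢uv eq ; (inj₂ eq) → ≢vu eq }) ¬xy′

-- Minimal generating complexes and spanning trees

module _ {A : Set} (A↔2 : A ↔ Fin 2) {n : ℕ} {r other : Fin n} (other≢r : other ≢ r)
         (K : Complex n) where

  -- The skeleton is connected, so its graph complex already generates, and minimality forces `K` to
  -- equal it. On a cycle, deleting an edge would leave a smaller generating complex.
  minimal⇒tree : MinimalGenerating A↔2 K (Eq A n) → IsSpanningTree K
  minimal⇒tree (gen , minimal) = G , (conn , acyclic) , (λ {S} → K⊆G {S}) , G⊆K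
    where
    G : Graph n
    G = skeleton K

    conn : Connected G
    conn = generates⇒connected A↔2 K gen

    G⊆K : graphComplex G ⊆ᶜ K
    G⊆K = skeleton⊆ K other≢r conn

    K⊆G : K ⊆ᶜ graphComplex G
    K⊆G {S} KS = decidable-stable (Complex.simplex? (graphComplex G) S) λ ¬GS →
      minimal (graphComplex G) (G⊆K , λ K⊆G → ¬GS (K⊆G KS))
        (connected⇒generates A↔2 G other≢r conn)

    acyclic : Acyclic G
    acyclic u us cycle with v , uv , conn′ ← cycle-edge-redundant G conn cycle =
      minimal (graphComplex (removeEdge G u v))
        ((λ {S} S∈ → G⊆K (proj₁ (removeEdge⊂ G uv) {S} S∈)) ,
         λ K⊆ → proj₂ (removeEdge⊂ G uv) (λ {S} GS → K⊆ (G⊆K GS)))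
        (connected⇒generates A↔2 (removeEdge G u v) other≢r conn′)

  -- A generating subcomplex has a connected skeleton inside the tree, and must keep all vertices
  -- and edges.
  tree⇒minimal : IsSpanningTree K → MinimalGenerating A↔2 K (Eq A n)
  tree⇒minimal (G , (conn , acyclic) , K⊆G , G⊆K) =
    generates-mono A↔2 {K = graphComplex G} {K} {Eq A n} G⊆K
      (connected⇒generates A↔2 G other≢r conn) ,
    λ K′ (K′⊆K , K⊈K′) gen′ → K⊈K′ λ {S} KS →
      full K′ (λ {S} K′S → K⊆G (K′⊆K {S} K′S)) (generates⇒connected A↔2 K′ gen′) (K⊆G KS)
    where
    module _ (K′ : Complex n) (K′⊆G : K′ ⊆ᶜ graphComplex G) (conn′ : Connected (skeleton K′)) where

      edge⊆ : ∀ {u v} → Graph.Edge (skeleton K′) u v → Graph.Edge G u v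
      edge⊆ (u≢v , uv) = pair-simplex⇒edge G u≢v (K′⊆G uv)

      -- If the edge were missing, a simple path in `K′` would join its ends through some third
      -- vertex, and with the edge form a cycle in `G`.
      edge-kept : ∀ {u v} → Graph.Edge G u v → Simplex K′ (⁅ u ⁆ ∪ ⁅ v ⁆)
      edge-kept {u} {v} uv = decidable-stable (Complex.simplex? K′ _) λ ¬uv →
        impossible ¬uv (simple-path (skeleton K′) u≢v (conn′ u v))
        where
        u≢v : u ≢ v
        u≢v refl = Graph.irrefl G u uv

        impossible : ¬ Simplex K′ (⁅ u ⁆ ∪ ⁅ v ⁆) →
          ¬ (∃ λ mid → Linked (Graph.Edge (skeleton K′)) (u ∷ mid ++ v ∷ []) ×
                       Unique (v ∷ u ∷ mid))
        impossible ¬uv ([] , (_ , uv′) ∷ _ , _) = ¬uv uv′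
        impossible ¬uv (w ∷ mid , linked , unique) = acyclic v (u ∷ w ∷ mid)
          ( s≤s (s≤s (s≤s z≤n)) , unique
          , Graph.symm G uv ∷ Linked.map edge⊆ linked )

      full : graphComplex G ⊆ᶜ K′
      full (inj₁ refl)                       = Complex.empty K′
      full (inj₂ (inj₁ (v , refl)))          =
        vertex∈skeleton K′ (proj₂ (another other≢r v)) conn′
      full (inj₂ (inj₂ (u , v , uv , refl))) = edge-kept uv

proposition4p4 : (A : Set) (A↔2 : A ↔ Fin 2) (n : ℕ) → n ≥ 3 →
    (K : Complex n) → MinimalGenerating A↔2 K (Eq A n) ⇔ IsSpanningTree K
proposition4p4 A A↔2 (suc (suc n)) (s≤s (s≤s _)) K =
  mk⇔ (minimal⇒tree A↔2 1≢0 K) (tree⇒minimal A↔2 1≢0 K)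
  where
  1≢0 : suc zero ≢ zero {suc n}
  1≢0 ()
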